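{- Let $A(t)=\sum_{n\ge1}|{\bf I}_n(201,210)|\,t^n$. Then $$(2t^2-2t+1)A^2+(4t^2-3t)A+2t^2=0,$$ and $$A(t)=\frac{3t-4t^2-t\sqrt{1-8t}}{4t^2-4t+2}.$$
   Context: ${\bf I}_n=\{(e_1,\dots,e_n)\in\mathbb{N}^n:0\le e_i<i\}$ is the set of inversion sequences of length $n$; ${\bf I}_n(201,210)$ consists of those $e$ with no indices $i<j<k$ such that $e_j<e_k<e_i$ (pattern $201$) or $e_k<e_j<e_i$ (pattern $210$). -}

module Defs where

open import Data.Nat as ℕ using (ℕ; zero; suc)
open import Data.Fin as Fin using (Fin; toℕ)
open import Data.Vec using (Vec; lookup)
open import Data.Integer as ℤ using (ℤ; +_)
open import Data.List using (List; []; _∷_)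
open import Data.Product using (∃-syntax; _×_)
open import Relation.Nullary using (¬_)
open import Function.Bundles using (_↔_)

-- Inversion sequences and pattern avoidance
-- A vector e of length n, 0-indexed: position i (i = 0..n-1) holds
-- e_{i+1} in the paper's 1-indexed notation, constrained by e_{i+1} < i+1.

IsInvSeq : {n : ℕ} → Vec ℕ n → Set
IsInvSeq {n} e = (i : Fin n) → lookup e i ℕ.< suc (toℕ i)

Has201 : {n : ℕ} → Vec ℕ n → Set
Has201 {n} e = ∃[ i ] ∃[ j ] ∃[ k ] (i Fin.< j × j Fin.< k ×
  lookup e j ℕ.< lookup e k × lookup e k ℕ.< lookup e i)

Has210 : {n : ℕ} → Vec ℕ n → Set
Has210 {n} e = ∃[ i ] ∃[ j ] ∃[ k ] (i Fin.< j × j Fin.< k ×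
  lookup e k ℕ.< lookup e j × lookup e j ℕ.< lookup e i)

-- the set I_n(201,210); the property fields are irrelevant so that
-- elements are identified by their underlying sequence
record I₂₀₁₋₂₁₀ (n : ℕ) : Set where
  constructor mk
  field
    seq      : Vec ℕ n
    .isInv   : IsInvSeq seq
    .no201   : ¬ Has201 seq
    .no210   : ¬ Has210 seq

-- a n = |I_n(201,210)| for n ≥ 1, and a 0 = 0 (the series starts at n = 1)
IsCoeffSeq : (ℕ → ℕ) → Set
IsCoeffSeq a = (a 0 ≡ 0) × ((n : ℕ) → Fin (a (suc n)) ↔ I₂₀₁₋₂₁₀ (suc n))
  where open import Relation.Binary.PropositionalEquality using (_≡_)

Series : Set
Series = ℕ → ℤ

_⊕_ : Series → Series → Series
(f ⊕ g) n = f n ℤ.+ g n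

_⊖_ : Series → Series → Series
(f ⊖ g) n = f n ℤ.- g n

_⊛_ : Series → Series → Series
(f ⊛ g) n = go n
  where
  go : ℕ → ℤ
  go zero    = f 0 ℤ.* g n
  go (suc k) = go k ℤ.+ f (suc k) ℤ.* g (n ℕ.∸ suc k)

infixl 6 _⊕_ _⊖_
infixl 7 _⊛_

poly : List ℤ → Series
poly []       _       = + 0
poly (c ∷ cs) zero    = c
poly (c ∷ cs) (suc n) = poly cs n

ser : (ℕ → ℕ) → Series
ser a n = + a n

{-# OPTIONS --safe #-}
-- Avoiding 201 and 210 means that the entries after e_i that are smaller than e_i are all
-- equal. So a prefix with maximum M constrains its completion only through the bound k + M on
-- the next entry and the list L of values below M that may still occur: an entry v ∈ L
-- replaces L by {v}, and an entry v ≥ M replaces M by v and adjoins M, …, v - 1 to L.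
-- Hence the number of completions of length m depends only on k and t = |L|. It is affine in
-- t, and summing over m gives, with V = 1 + 2XV² and G = 1 + XG(1 + V),
--   G (1 + XV² (1 + V + … + V^(p-1)) + t X V^(p+2))   for k = p + 1,
-- where the kernel method suggests the formula and the recurrence verifies it. In particular
-- A = XG; eliminating V gives the quadratic equation, and (1 - 4XV)² = 1 - 8X the closed form.
module Submission where

open import Defs
open import Algebra.Bundles using (CommutativeRing)
import Algebra.Solver.Ring
open import Algebra.Solver.Ring.AlmostCommutativeRing using (fromCommutativeRing; _-Raw-AlmostCommutative⟶_)
open import Data.Fin as Fin using (Fin; zero; suc; toℕ)
open import Data.Fin.Permutation using (↔⇒≡)
import Data.Fin.Properties as Finₚ
open import Data.Integer as ℤ using (ℤ; +_; -_)
import Data.Integer.Properties as ℤₚ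
open import Data.Integer.Solver using (module +-*-Solver)
open import Data.List as List using (List; []; _∷_; _++_; map; concatMap; length)
open import Data.List.Membership.DecPropositional using (_∈?_)
open import Data.List.Membership.Propositional using (_∈_)
open import Data.List.Membership.Propositional.Properties using (∈-++⁺ˡ; ∈-++⁺ʳ; ∈-++⁻; ∈-map⁺; ∈-map⁻; ∈-concatMap⁺; ∈-lookup)
import Data.List.Properties as Listₚ
open import Data.List.Relation.Binary.Disjoint.Propositional using (Disjoint)
open import Data.List.Relation.Unary.All as All using (All; []; _∷_)
open import Data.List.Relation.Unary.AllPairs using ([]; _∷_)
open import Data.List.Relation.Unary.Any as Any using (here; there)
open import Data.List.Relation.Unary.Any.Properties using (lookup-index)
open import Data.List.Relation.Unary.Unique.Propositional using (Unique)
open import Data.List.Relation.Unary.Unique.Propositional.Properties using (map⁺; ++⁺)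
import Data.Maybe as Maybe
open import Data.Nat as ℕ using (ℕ; zero; suc; z≤n; s≤s; _≤_; _<_)
import Data.Nat.Properties as ℕₚ
open import Data.Product using (_×_; _,_; proj₁)
open import Data.Sum using (inj₁; inj₂)
open import Data.Vec using (Vec; []; _∷_; lookup; head)
open import Data.Vec.Properties using (∷-injectiveʳ; ≡-dec)
open import Function.Bundles using (_↔_; mk↔ₛ′)
open import Function.Properties.Inverse using (↔-sym; ↔-trans)
open import Level using (0ℓ)
open import Relation.Binary.Definitions using (tri<; tri≈; tri>)
open import Relation.Binary.PropositionalEquality using (_≡_; _≢_; refl; sym; trans; cong; cong₂; subst; module ≡-Reasoning)
import Relation.Binary.Reasoning.Setoid as SetoidReasoning
open import Relation.Nullary using (¬_; contradiction)
open import Relation.Nullary.Decidable using (dec⇒maybe; recompute)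

-- The ring of formal power series

infix 4 _≈_

_≈_ : Series → Series → Set
f ≈ g = ∀ n → f n ≡ g n

tail : Series → Series
tail f n = f (suc n)

const : ℤ → Series
const c = poly (c ∷ [])

X : Series
X = poly (+ 0 ∷ + 1 ∷ [])

-- The local function of _⊛_ has no name outside Defs; abstracting over the
-- upper bound and over addition leaves a unification problem whose only
-- solution is that function.
mutual
  partial-⊛ : Series → Series → ℕ → ℕ → ℤ
  partial-⊛ = _

  ⊛-last : ∀ f g n → (f ⊛ g) (suc n) ≡ partial-⊛ f g (suc n) n ℤ.+ f (suc n) ℤ.* g (n ℕ.∸ n)
  ⊛-last f g n with suc n | ℤ._+_
  ... | _ | _ = refl

-- The bound `k` varies independently of `n` because the recursion behind `⊛` lowers only the bound.
-- The case `k = n` is `⊛-suc`, which lets the ring laws be proved by induction on the coefficient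
-- index.
partial-⊛-suc : ∀ f g n k → partial-⊛ f g (suc n) (suc k) ≡ f 0 ℤ.* g (suc n) ℤ.+ partial-⊛ (tail f) g n k
partial-⊛-suc f g n zero    = refl
partial-⊛-suc f g n (suc k) = trans
  (cong (ℤ._+ f (suc (suc k)) ℤ.* g (n ℕ.∸ suc k)) (partial-⊛-suc f g n k))
  (ℤₚ.+-assoc (f 0 ℤ.* g (suc n)) _ _)

⊛-suc : ∀ f g n → (f ⊛ g) (suc n) ≡ f 0 ℤ.* g (suc n) ℤ.+ (tail f ⊛ g) n
⊛-suc f g n = partial-⊛-suc f g n n

⊛-sucʳ : ∀ f g n → (f ⊛ g) (suc n) ≡ (f ⊛ tail g) n ℤ.+ f (suc n) ℤ.* g 0
⊛-sucʳ f g zero    = refl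
⊛-sucʳ f g (suc n) = begin
  (f ⊛ g) (suc (suc n))                                ≡⟨ ⊛-suc f g (suc n) ⟩
  f 0 ℤ.* g (suc (suc n)) ℤ.+ (tail f ⊛ g) (suc n)     ≡⟨ cong (λ z → f 0 ℤ.* g (suc (suc n)) ℤ.+ z) (⊛-sucʳ (tail f) g n) ⟩
  f 0 ℤ.* g (suc (suc n)) ℤ.+ ((tail f ⊛ tail g) n ℤ.+ f (suc (suc n)) ℤ.* g 0)
                                                       ≡⟨ ℤₚ.+-assoc (f 0 ℤ.* g (suc (suc n))) _ _ ⟨
  f 0 ℤ.* g (suc (suc n)) ℤ.+ (tail f ⊛ tail g) n ℤ.+ f (suc (suc n)) ℤ.* g 0
                                                       ≡⟨ cong (ℤ._+ f (suc (suc n)) ℤ.* g 0) (⊛-suc f (tail g) n) ⟨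
  (f ⊛ tail g) (suc n) ℤ.+ f (suc (suc n)) ℤ.* g 0     ∎
  where open ≡-Reasoning

⊛-cong : ∀ {f f′ g g′} → f ≈ f′ → g ≈ g′ → f ⊛ g ≈ f′ ⊛ g′
⊛-cong                   p q zero    = cong₂ ℤ._*_ (p 0) (q 0)
⊛-cong {f} {f′} {g} {g′} p q (suc n) = begin
  (f ⊛ g) (suc n)                             ≡⟨ ⊛-suc f g n ⟩
  f 0 ℤ.* g (suc n) ℤ.+ (tail f ⊛ g) n        ≡⟨ cong₂ ℤ._+_ (cong₂ ℤ._*_ (p 0) (q (suc n))) (⊛-cong (λ k → p (suc k)) q n) ⟩
  f′ 0 ℤ.* g′ (suc n) ℤ.+ (tail f′ ⊛ g′) n    ≡⟨ ⊛-suc f′ g′ n ⟨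
  (f′ ⊛ g′) (suc n)                           ∎
  where open ≡-Reasoning

⊛-comm : ∀ f g → f ⊛ g ≈ g ⊛ f
⊛-comm f g zero    = ℤₚ.*-comm (f 0) (g 0)
⊛-comm f g (suc n) = begin
  (f ⊛ g) (suc n)                         ≡⟨ ⊛-suc f g n ⟩
  f 0 ℤ.* g (suc n) ℤ.+ (tail f ⊛ g) n    ≡⟨ cong₂ ℤ._+_ (ℤₚ.*-comm (f 0) _) (⊛-comm (tail f) g n) ⟩
  g (suc n) ℤ.* f 0 ℤ.+ (g ⊛ tail f) n    ≡⟨ ℤₚ.+-comm (g (suc n) ℤ.* f 0) _ ⟩
  (g ⊛ tail f) n ℤ.+ g (suc n) ℤ.* f 0    ≡⟨ ⊛-sucʳ g f n ⟨
  (g ⊛ f) (suc n)                         ∎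
  where open ≡-Reasoning

⊛-distribʳ-⊕ : ∀ h f g → (f ⊕ g) ⊛ h ≈ f ⊛ h ⊕ g ⊛ h
⊛-distribʳ-⊕ h f g zero    = ℤₚ.*-distribʳ-+ (h 0) (f 0) (g 0)
⊛-distribʳ-⊕ h f g (suc n) = begin
  ((f ⊕ g) ⊛ h) (suc n)
    ≡⟨ ⊛-suc (f ⊕ g) h n ⟩
  (f 0 ℤ.+ g 0) ℤ.* h (suc n) ℤ.+ ((tail f ⊕ tail g) ⊛ h) n
    ≡⟨ cong (λ z → (f 0 ℤ.+ g 0) ℤ.* h (suc n) ℤ.+ z) (⊛-distribʳ-⊕ h (tail f) (tail g) n) ⟩
  (f 0 ℤ.+ g 0) ℤ.* h (suc n) ℤ.+ ((tail f ⊛ h) n ℤ.+ (tail g ⊛ h) n)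
    ≡⟨ solve 5 (λ a b c d e → (a :+ b) :* c :+ (d :+ e) := (a :* c :+ d) :+ (b :* c :+ e)) refl (f 0) (g 0) (h (suc n)) _ _ ⟩
  (f 0 ℤ.* h (suc n) ℤ.+ (tail f ⊛ h) n) ℤ.+ (g 0 ℤ.* h (suc n) ℤ.+ (tail g ⊛ h) n)
    ≡⟨ cong₂ ℤ._+_ (⊛-suc f h n) (⊛-suc g h n) ⟨
  (f ⊛ h ⊕ g ⊛ h) (suc n) ∎
  where open ≡-Reasoning
        open +-*-Solver

-- The tail of `f ⊛ g` is `scale (f 0) (tail g) ⊕ tail f ⊛ g`, so associativity needs such scalar
-- multiples to pass through products.
scale : ℤ → Series → Series
scale c f n = c ℤ.* f n

scale-⊛ : ∀ c f g → scale c f ⊛ g ≈ scale c (f ⊛ g)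
scale-⊛ c f g zero    = ℤₚ.*-assoc c (f 0) (g 0)
scale-⊛ c f g (suc n) = begin
  (scale c f ⊛ g) (suc n)                                     ≡⟨ ⊛-suc (scale c f) g n ⟩
  c ℤ.* f 0 ℤ.* g (suc n) ℤ.+ (scale c (tail f) ⊛ g) n        ≡⟨ cong₂ ℤ._+_ (ℤₚ.*-assoc c (f 0) _) (scale-⊛ c (tail f) g n) ⟩
  c ℤ.* (f 0 ℤ.* g (suc n)) ℤ.+ c ℤ.* (tail f ⊛ g) n          ≡⟨ ℤₚ.*-distribˡ-+ c _ _ ⟨
  c ℤ.* (f 0 ℤ.* g (suc n) ℤ.+ (tail f ⊛ g) n)                ≡⟨ cong (c ℤ.*_) (⊛-suc f g n) ⟨
  c ℤ.* (f ⊛ g) (suc n)                                       ∎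
  where open ≡-Reasoning

⊛-assoc : ∀ f g h → (f ⊛ g) ⊛ h ≈ f ⊛ (g ⊛ h)
⊛-assoc f g h zero    = ℤₚ.*-assoc (f 0) (g 0) (h 0)
⊛-assoc f g h (suc n) = begin
  ((f ⊛ g) ⊛ h) (suc n)
    ≡⟨ ⊛-suc (f ⊛ g) h n ⟩
  f 0 ℤ.* g 0 ℤ.* h (suc n) ℤ.+ (tail (f ⊛ g) ⊛ h) n
    ≡⟨ cong (λ z → f 0 ℤ.* g 0 ℤ.* h (suc n) ℤ.+ z) (⊛-cong {g = h} (⊛-suc f g) (λ _ → refl) n) ⟩
  f 0 ℤ.* g 0 ℤ.* h (suc n) ℤ.+ ((scale (f 0) (tail g) ⊕ tail f ⊛ g) ⊛ h) n
    ≡⟨ cong (λ z → f 0 ℤ.* g 0 ℤ.* h (suc n) ℤ.+ z) (⊛-distribʳ-⊕ h (scale (f 0) (tail g)) (tail f ⊛ g) n) ⟩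
  f 0 ℤ.* g 0 ℤ.* h (suc n) ℤ.+ ((scale (f 0) (tail g) ⊛ h) n ℤ.+ ((tail f ⊛ g) ⊛ h) n)
    ≡⟨ cong (λ z → f 0 ℤ.* g 0 ℤ.* h (suc n) ℤ.+ z) (cong₂ ℤ._+_ (scale-⊛ (f 0) (tail g) h n) (⊛-assoc (tail f) g h n)) ⟩
  f 0 ℤ.* g 0 ℤ.* h (suc n) ℤ.+ (f 0 ℤ.* (tail g ⊛ h) n ℤ.+ (tail f ⊛ (g ⊛ h)) n)
    ≡⟨ solve 5 (λ a b c d e → a :* b :* c :+ (a :* d :+ e) := a :* (b :* c :+ d) :+ e) refl (f 0) (g 0) (h (suc n)) _ _ ⟩
  f 0 ℤ.* (g 0 ℤ.* h (suc n) ℤ.+ (tail g ⊛ h) n) ℤ.+ (tail f ⊛ (g ⊛ h)) n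
    ≡⟨ cong (λ z → f 0 ℤ.* z ℤ.+ (tail f ⊛ (g ⊛ h)) n) (⊛-suc g h n) ⟨
  f 0 ℤ.* (g ⊛ h) (suc n) ℤ.+ (tail f ⊛ (g ⊛ h)) n
    ≡⟨ ⊛-suc f (g ⊛ h) n ⟨
  (f ⊛ (g ⊛ h)) (suc n) ∎
  where open ≡-Reasoning
        open +-*-Solver

poly[]-⊛ : ∀ f → poly [] ⊛ f ≈ poly []
poly[]-⊛ f zero    = refl
poly[]-⊛ f (suc n) = trans (⊛-suc (poly []) f n)
  (trans (ℤₚ.+-identityˡ _) (poly[]-⊛ f n))

const-⊛ : ∀ c f → const c ⊛ f ≈ scale c f
const-⊛ c f zero    = refl
const-⊛ c f (suc n) = trans (⊛-suc (const c) f n)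
  (trans (cong (λ z → c ℤ.* f (suc n) ℤ.+ z) (poly[]-⊛ f n)) (ℤₚ.+-identityʳ _))

X-⊛ : ∀ f n → (X ⊛ f) (suc n) ≡ f n
X-⊛ f n = trans (⊛-suc X f n)
  (trans (ℤₚ.+-identityˡ _) (trans (const-⊛ (+ 1) f n) (ℤₚ.*-identityˡ (f n))))

⊛-identityˡ : ∀ f → const (+ 1) ⊛ f ≈ f
⊛-identityˡ f n = trans (const-⊛ (+ 1) f n) (ℤₚ.*-identityˡ (f n))

poly-∷ : ∀ c cs → poly (c ∷ cs) ≈ const c ⊕ X ⊛ poly cs
poly-∷ c cs zero    = sym (ℤₚ.+-identityʳ c)
poly-∷ c cs (suc n) = sym (trans (ℤₚ.+-identityˡ _) (X-⊛ (poly cs) n))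

seriesRing : CommutativeRing 0ℓ 0ℓ
seriesRing = record
  { Carrier = Series
  ; _≈_ = _≈_
  ; _+_ = _⊕_
  ; _*_ = _⊛_
  ; -_ = λ f n → - f n
  ; 0# = poly []
  ; 1# = const (+ 1)
  ; isCommutativeRing = record
    { isRing = record
      { +-isAbelianGroup = record
        { isGroup = record
          { isMonoid = record
            { isSemigroup = record
              { isMagma = record
                { isEquivalence = record
                  { refl  = λ _ → refl
                  ; sym   = λ p n → sym (p n)
                  ; trans = λ p q n → trans (p n) (q n)
                  }
                ; ∙-cong = λ p q n → cong₂ ℤ._+_ (p n) (q n)
                }
              ; assoc = λ f g h n → ℤₚ.+-assoc (f n) (g n) (h n)
              }
            ; identity = (λ f n → ℤₚ.+-identityˡ (f n)) , (λ f n → ℤₚ.+-identityʳ (f n))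
            }
          ; inverse = (λ f n → ℤₚ.+-inverseˡ (f n)) , (λ f n → ℤₚ.+-inverseʳ (f n))
          ; ⁻¹-cong = λ p n → cong -_ (p n)
          }
        ; comm = λ f g n → ℤₚ.+-comm (f n) (g n)
        }
      ; *-cong = ⊛-cong
      ; *-assoc = ⊛-assoc
      ; *-identity = ⊛-identityˡ , λ f n → trans (⊛-comm f (const (+ 1)) n) (⊛-identityˡ f n)
      ; distrib = (λ h f g n → trans (⊛-comm h (f ⊕ g) n)
                    (trans (⊛-distribʳ-⊕ h f g n) (cong₂ ℤ._+_ (⊛-comm f h n) (⊛-comm g h n))))
                , ⊛-distribʳ-⊕
      }
    ; *-comm = ⊛-comm
    }
  }

open CommutativeRing seriesRing using () renaming
  ( refl to ≈-refl; sym to ≈-sym; trans to ≈-trans; setoid to seriesSetoid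
  ; +-cong to ⊕-cong; +-congˡ to ⊕-congˡ; +-congʳ to ⊕-congʳ; *-congˡ to ⊛-congˡ; *-congʳ to ⊛-congʳ)

-- Equality of series is undecidable, so the solver computes with integer coefficients, embedded as
-- constant series.
const-morphism : ℤ.+-*-rawRing -Raw-AlmostCommutative⟶ fromCommutativeRing seriesRing
const-morphism = record
  { ⟦_⟧    = const
  ; +-homo = λ { c d zero → refl ; c d (suc n) → refl }
  ; *-homo = λ { c d zero → refl ; c d (suc n) → sym (trans (const-⊛ c (const d) (suc n)) (ℤₚ.*-zeroʳ c)) }
  ; -‿homo = λ { c zero → refl ; c (suc n) → refl }
  ; 0-homo = λ { zero → refl ; (suc n) → refl }
  ; 1-homo = λ _ → refl
  }

module SeriesSolver = Algebra.Solver.Ring ℤ.+-*-rawRing (fromCommutativeRing seriesRing) const-morphism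
  (λ c d → Maybe.map (λ c≡d n → cong (λ z → const z n) c≡d) (dec⇒maybe (c ℤ.≟ d)))

open SeriesSolver using (solve; con; _:=_; _:+_; _:*_; _:-_)

-- Counting completions

-- Completes k M L w: w can follow a prefix with maximum M, of length k + M, after which the
-- values below M that remain admissible are those in L, and at most one of them may be used.
record Completes (k M : ℕ) (L : List ℕ) {m : ℕ} (w : Vec ℕ m) : Set where
  field
    bounded : ∀ i → lookup w i ≤ k ℕ.+ M ℕ.+ toℕ i
    low-∈   : ∀ i → lookup w i < M → lookup w i ∈ L
    low-≡   : ∀ i j → lookup w i < M → lookup w j < M → lookup w i ≡ lookup w j
    avoids  : ∀ i j l → i Fin.< j → i Fin.< l → lookup w j < lookup w i → lookup w l < lookup w i →
              lookup w j ≡ lookup w l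

module _ {k M : ℕ} {L : List ℕ} {m : ℕ} {w : Vec ℕ m} where

  bounded-tail : ∀ {v} → (∀ i → lookup (v ∷ w) i ≤ k ℕ.+ M ℕ.+ toℕ i) → ∀ i → lookup w i ≤ suc k ℕ.+ M ℕ.+ toℕ i
  bounded-tail b i = subst (lookup w i ≤_) (ℕₚ.+-suc (k ℕ.+ M) (toℕ i)) (b (suc i))

  bounded-cons : ∀ {v} → v ≤ k ℕ.+ M → (∀ i → lookup w i ≤ suc k ℕ.+ M ℕ.+ toℕ i) →
                 ∀ i → lookup (v ∷ w) i ≤ k ℕ.+ M ℕ.+ toℕ i
  bounded-cons v≤ b zero    = ℕₚ.≤-trans v≤ (ℕₚ.m≤m+n (k ℕ.+ M) 0)
  bounded-cons v≤ b (suc i) = subst (lookup w i ≤_) (sym (ℕₚ.+-suc (k ℕ.+ M) (toℕ i))) (b i)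

  -- An entry `v ≤ M` in front can be the large entry of a pattern only over entries below `M`, and
  -- those are all equal.
  avoids-cons : ∀ {v} → v ≤ M → (∀ i j → lookup w i < M → lookup w j < M → lookup w i ≡ lookup w j) →
    (∀ i j l → i Fin.< j → i Fin.< l → lookup w j < lookup w i → lookup w l < lookup w i → lookup w j ≡ lookup w l) →
    ∀ i j l → i Fin.< j → i Fin.< l → lookup (v ∷ w) j < lookup (v ∷ w) i → lookup (v ∷ w) l < lookup (v ∷ w) i →
    lookup (v ∷ w) j ≡ lookup (v ∷ w) l
  avoids-cons v≤M eq av zero    (suc j) (suc l) _         _         wj<v  wl<v  = eq j l (ℕₚ.<-≤-trans wj<v v≤M) (ℕₚ.<-≤-trans wl<v v≤M)
  avoids-cons v≤M eq av (suc i) (suc j) (suc l) (s≤s i<j) (s≤s i<l) wj<wi wl<wi = av i j l i<j i<l wj<wi wl<wi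

  -- By `low-≡`, later values below `M` must equal the one just used, so the admissible list shrinks
  -- to a singleton.
  low⁻ : ∀ {v} → v < M → Completes k M L (v ∷ w) → v ∈ L × Completes (suc k) M (v ∷ []) w
  low⁻ v<M c = low-∈ zero v<M , record
    { bounded = bounded-tail bounded
    ; low-∈   = λ i wi<M → here (low-≡ (suc i) zero wi<M v<M)
    ; low-≡   = λ i j → low-≡ (suc i) (suc j)
    ; avoids  = λ i j l i<j i<l → avoids (suc i) (suc j) (suc l) (s≤s i<j) (s≤s i<l)
    }
    where open Completes c

  low⁺ : ∀ {v} → v < M → v ∈ L → Completes (suc k) M (v ∷ []) w → Completes k M L (v ∷ w)
  low⁺ {v} v<M v∈L c = record
    { bounded = bounded-cons (ℕₚ.≤-trans (ℕₚ.<⇒≤ v<M) (ℕₚ.m≤n+m M k)) bounded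
    ; low-∈   = λ { zero _ → v∈L ; (suc i) wi<M → subst (_∈ L) (sym (≡v i wi<M)) v∈L }
    ; low-≡   = λ { zero    zero    _    _    → refl
                  ; zero    (suc j) _    wj<M → sym (≡v j wj<M)
                  ; (suc i) zero    wi<M _    → ≡v i wi<M
                  ; (suc i) (suc j) wi<M wj<M → low-≡ i j wi<M wj<M }
    ; avoids  = avoids-cons (ℕₚ.<⇒≤ v<M) low-≡ avoids
    }
    where
    open Completes c
    ≡v : ∀ i → lookup w i < M → lookup w i ≡ v
    ≡v i wi<M with here eq ← low-∈ i wi<M = eq

  max⁻ : Completes k M L (M ∷ w) → Completes (suc k) M L w
  max⁻ c = record
    { bounded = bounded-tail bounded
    ; low-∈   = λ i → low-∈ (suc i)
    ; low-≡   = λ i j → low-≡ (suc i) (suc j)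
    ; avoids  = λ i j l i<j i<l → avoids (suc i) (suc j) (suc l) (s≤s i<j) (s≤s i<l)
    }
    where open Completes c

  max⁺ : Completes (suc k) M L w → Completes k M L (M ∷ w)
  max⁺ c = record
    { bounded = bounded-cons (ℕₚ.m≤n+m M k) bounded
    ; low-∈   = λ { zero M<M → contradiction M<M (ℕₚ.<-irrefl refl) ; (suc i) → low-∈ i }
    ; low-≡   = λ { zero    _       M<M _   → contradiction M<M (ℕₚ.<-irrefl refl)
                  ; (suc i) zero    _   M<M → contradiction M<M (ℕₚ.<-irrefl refl)
                  ; (suc i) (suc j)         → low-≡ i j }
    ; avoids  = avoids-cons ℕₚ.≤-refl low-≡ avoids
    }
    where open Completes c

  -- An entry above M makes M itself an admissible low value, without changing the bound on the entries.
  raise⁻ : ∀ {v} → M < v → Completes (suc k) M L (v ∷ w) → Completes k (suc M) (M ∷ L) (v ∷ w)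
  raise⁻ {v} M<v c = record
    { bounded = λ i → subst (λ b → lookup (v ∷ w) i ≤ b ℕ.+ toℕ i) (sym (ℕₚ.+-suc k M)) (bounded i)
    ; low-∈   = ∈M∷L
    ; low-≡   = λ { zero    _       v≤M       _         → contradiction (ℕₚ.≤-trans v≤M M<v) (ℕₚ.<-irrefl refl)
                  ; (suc i) zero    _         v≤M       → contradiction (ℕₚ.≤-trans v≤M M<v) (ℕₚ.<-irrefl refl)
                  ; (suc i) (suc j) wi≤M wj≤M → avoids zero (suc i) (suc j) (s≤s z≤n) (s≤s z≤n)
                                                  (ℕₚ.≤-trans wi≤M M<v) (ℕₚ.≤-trans wj≤M M<v) }
    ; avoids  = avoids
    }
    where
    open Completes c
    ∈M∷L : ∀ i → lookup (v ∷ w) i < suc M → lookup (v ∷ w) i ∈ M ∷ L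
    ∈M∷L i (s≤s x≤M) with ℕₚ.m≤n⇒m<n∨m≡n x≤M
    ... | inj₁ x<M = there (low-∈ i x<M)
    ... | inj₂ x≡M = here x≡M

-- A value below `M` that lies in `M ∷ L` is not `M`, so it lies in `L`.
raise⁺ : ∀ {k M L m} {w : Vec ℕ m} → Completes k (suc M) (M ∷ L) w → Completes (suc k) M L w
raise⁺ {k} {M} {L} {w = w} c = record
  { bounded = λ i → subst (λ b → lookup w i ≤ b ℕ.+ toℕ i) (ℕₚ.+-suc k M) (bounded i)
  ; low-∈   = ∈L
  ; low-≡   = λ i j wi<M wj<M → low-≡ i j (ℕₚ.m≤n⇒m≤1+n wi<M) (ℕₚ.m≤n⇒m≤1+n wj<M)
  ; avoids  = avoids
  }
  where
  open Completes c
  ∈L : ∀ i → lookup w i < M → lookup w i ∈ L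
  ∈L i wi<M with low-∈ i (ℕₚ.m≤n⇒m≤1+n wi<M)
  ... | here wi≡M  = contradiction wi≡M (ℕₚ.<⇒≢ wi<M)
  ... | there wi∈L = wi∈L

-- Enumeration of the completions

module _ {m : ℕ} (E : ℕ → List (Vec ℕ m)) where

  prepend : List ℕ → List (Vec ℕ (suc m))
  prepend = concatMap (λ v → map (v ∷_) (E v))

  ∈-prepend⁺ : ∀ {L v w} → v ∈ L → w ∈ E v → v ∷ w ∈ prepend L
  ∈-prepend⁺ {L} v∈L w∈E = ∈-concatMap⁺ (λ v → map (v ∷_) (E v))
    (Any.map (λ { refl → ∈-map⁺ _ w∈E }) v∈L)

  ∈-prepend⁻ : ∀ L {v w} → v ∷ w ∈ prepend L → v ∈ L × w ∈ E v
  ∈-prepend⁻ (u ∷ L) p with ∈-++⁻ (map (u ∷_) (E u)) p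
  ... | inj₂ q with v∈L , w∈E ← ∈-prepend⁻ L q = there v∈L , w∈E
  ... | inj₁ q with _ , w∈E , refl ← ∈-map⁻ (u ∷_) q = here refl , w∈E

  prepend-unique : ∀ {L} → All (λ v → Unique (E v)) L → Unique L → Unique (prepend L)
  prepend-unique             []         []         = []
  prepend-unique {L = v ∷ L} (Ev! ∷ E!) (v∉L ∷ L!) = ++⁺ (map⁺ ∷-injectiveʳ Ev!) (prepend-unique E! L!) disjoint
    where
    disjoint : Disjoint (map (v ∷_) (E v)) (prepend L)
    disjoint (p , q) with _ , _ , refl ← ∈-map⁻ (v ∷_) p = All.lookup v∉L (proj₁ (∈-prepend⁻ L q)) refl

  length-prepend : ∀ {c} → (∀ v → length (E v) ≡ c) → ∀ L → length (prepend L) ≡ length L ℕ.* c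
  length-prepend E≡c []      = refl
  length-prepend E≡c (v ∷ L) = trans (Listₚ.length-++ (map (v ∷_) (E v)))
    (cong₂ ℕ._+_ (trans (Listₚ.length-map (v ∷_) (E v)) (E≡c v)) (length-prepend E≡c L))

-- `ascending` treats a first entry of at least `M`, for which the `k + 1` values from `M` to
-- `k + M` are available. Passing from `M` to `suc M` keeps `k + M` fixed, so `k` drops by one and
-- the recursion is structural.
sequences : ∀ m → ℕ → ℕ → List ℕ → List (Vec ℕ m)
ascending : ∀ m → ℕ → ℕ → List ℕ → List (Vec ℕ (suc m))
sequences zero    k M L = [] ∷ []
sequences (suc m) k M L = prepend (λ v → sequences m (suc k) M (v ∷ [])) L ++ ascending m k M L
ascending m zero    M L = map (M ∷_) (sequences m 1 M L)
ascending m (suc k) M L = map (M ∷_) (sequences m (suc (suc k)) M L) ++ ascending m k (suc M) (M ∷ L)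

completions : ℕ → ℕ → ℕ → ℕ
weakAscents : ℕ → ℕ → ℕ → ℕ
completions zero    k t = 1
-- Each of the `t` low choices leaves a singleton list, hence the same count.
completions (suc m) k t = t ℕ.* completions m (suc k) 1 ℕ.+ weakAscents m k t
weakAscents m zero    t = completions m 1 t
weakAscents m (suc k) t = completions m (suc (suc k)) t ℕ.+ weakAscents m k (suc t)

length-sequences : ∀ m k M L → length (sequences m k M L) ≡ completions m k (length L)
length-ascending : ∀ m k M L → length (ascending m k M L) ≡ weakAscents m k (length L)
length-sequences zero    k M L = refl
length-sequences (suc m) k M L = trans (Listₚ.length-++ (prepend (λ v → sequences m (suc k) M (v ∷ [])) L))
  (cong₂ ℕ._+_ (length-prepend _ (λ v → length-sequences m (suc k) M (v ∷ [])) L) (length-ascending m k M L))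
length-ascending m zero    M L = trans (Listₚ.length-map (M ∷_) (sequences m 1 M L)) (length-sequences m 1 M L)
length-ascending m (suc k) M L = trans (Listₚ.length-++ (map (M ∷_) (sequences m (suc (suc k)) M L)))
  (cong₂ ℕ._+_ (trans (Listₚ.length-map (M ∷_) (sequences m (suc (suc k)) M L)) (length-sequences m (suc (suc k)) M L))
               (length-ascending m k (suc M) (M ∷ L)))

All-suc : ∀ {M L} → All (_< M) L → All (_< suc M) (M ∷ L)
All-suc L<M = ℕₚ.≤-refl ∷ All.map ℕₚ.m≤n⇒m≤1+n L<M

sequences-sound : ∀ m k M L → All (_< M) L → ∀ {w} → w ∈ sequences m k M L → Completes k M L w
ascending-sound : ∀ m k M L → All (_< M) L → ∀ {w} → w ∈ ascending m k M L → Completes k M L w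
sequences-sound zero    k M L L<M {[]} _ = record { bounded = λ () ; low-∈ = λ () ; low-≡ = λ () ; avoids = λ () }
sequences-sound (suc m) k M L L<M {v ∷ w} p with ∈-++⁻ (prepend (λ v → sequences m (suc k) M (v ∷ [])) L) p
... | inj₂ q = ascending-sound m k M L L<M q
... | inj₁ q with v∈L , w∈ ← ∈-prepend⁻ _ L q =
  low⁺ v<M v∈L (sequences-sound m (suc k) M (v ∷ []) (v<M ∷ []) w∈)
  where v<M = All.lookup L<M v∈L
ascending-sound m zero    M L L<M p with _ , w∈ , refl ← ∈-map⁻ (M ∷_) p = max⁺ (sequences-sound m 1 M L L<M w∈)
ascending-sound m (suc k) M L L<M p with ∈-++⁻ (map (M ∷_) (sequences m (suc (suc k)) M L)) p
... | inj₁ q with _ , w∈ , refl ← ∈-map⁻ (M ∷_) q = max⁺ (sequences-sound m (suc (suc k)) M L L<M w∈)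
... | inj₂ q = raise⁺ (ascending-sound m k (suc M) (M ∷ L) (All-suc L<M) q)

sequences-complete : ∀ m k M L {w} → Completes k M L w → w ∈ sequences m k M L
ascending-complete : ∀ m k M L {w} → M ≤ head w → Completes k M L w → w ∈ ascending m k M L
sequences-complete zero    k M L {[]}    c = here refl
sequences-complete (suc m) k M L {v ∷ w} c with ℕₚ.<-≤-connex v M
... | inj₂ M≤v = ∈-++⁺ʳ (prepend _ L) (ascending-complete m k M L M≤v c)
... | inj₁ v<M with v∈L , c′ ← low⁻ v<M c = ∈-++⁺ˡ (∈-prepend⁺ _ v∈L (sequences-complete m (suc k) M (v ∷ []) c′))
-- For `k = 0` the first entry is at most `M`, hence equal to it.
ascending-complete m zero    M L {v ∷ w} M≤v c
  with refl ← ℕₚ.≤-antisym M≤v (subst (v ≤_) (ℕₚ.+-identityʳ M) (Completes.bounded c zero)) =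
  ∈-map⁺ (M ∷_) (sequences-complete m 1 M L (max⁻ c))
ascending-complete m (suc k) M L {v ∷ w} M≤v c with ℕₚ.m≤n⇒m<n∨m≡n M≤v
... | inj₂ refl = ∈-++⁺ˡ (∈-map⁺ (M ∷_) (sequences-complete m (suc (suc k)) M L (max⁻ c)))
... | inj₁ M<v  = ∈-++⁺ʳ (map (M ∷_) (sequences m (suc (suc k)) M L)) (ascending-complete m k (suc M) (M ∷ L) M<v (raise⁻ M<v c))

-- This keeps the pieces of the enumeration disjoint: a low first entry is below `M`, and a first
-- entry `M` differs from one that is at least `suc M`.
ascending-head : ∀ m k M L {w} → w ∈ ascending m k M L → M ≤ head w
ascending-head m zero    M L p with _ , _ , refl ← ∈-map⁻ (M ∷_) p = ℕₚ.≤-refl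
ascending-head m (suc k) M L p with ∈-++⁻ (map (M ∷_) (sequences m (suc (suc k)) M L)) p
... | inj₁ q with _ , _ , refl ← ∈-map⁻ (M ∷_) q = ℕₚ.≤-refl
... | inj₂ q = ℕₚ.<⇒≤ (ascending-head m k (suc M) (M ∷ L) q)

sequences-unique : ∀ m k M L → All (_< M) L → Unique L → Unique (sequences m k M L)
ascending-unique : ∀ m k M L → All (_< M) L → Unique L → Unique (ascending m k M L)
sequences-unique zero    k M L L<M L! = [] ∷ []
sequences-unique (suc m) k M L L<M L! = ++⁺
  (prepend-unique _ (All.map (λ {v} v<M → sequences-unique m (suc k) M (v ∷ []) (v<M ∷ []) ([] ∷ [])) L<M) L!)
  (ascending-unique m k M L L<M L!) disjoint
  where
  disjoint : Disjoint (prepend (λ v → sequences m (suc k) M (v ∷ [])) L) (ascending m k M L)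
  disjoint {v ∷ w} (p , q) =
    ℕₚ.<⇒≱ (All.lookup L<M (proj₁ (∈-prepend⁻ _ L p))) (ascending-head m k M L q)
ascending-unique m zero    M L L<M L! = map⁺ ∷-injectiveʳ (sequences-unique m 1 M L L<M L!)
ascending-unique m (suc k) M L L<M L! = ++⁺
  (map⁺ ∷-injectiveʳ (sequences-unique m (suc (suc k)) M L L<M L!))
  (ascending-unique m k (suc M) (M ∷ L) (All-suc L<M) (All.map (λ v<M → ℕₚ.>⇒≢ v<M) L<M ∷ L!))
  disjoint
  where
  disjoint : Disjoint (map (M ∷_) (sequences m (suc (suc k)) M L)) (ascending m k (suc M) (M ∷ L))
  disjoint (p , q) with _ , _ , refl ← ∈-map⁻ (M ∷_) p = ℕₚ.<-irrefl refl (ascending-head m k (suc M) (M ∷ L) q)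

-- Inversion sequences as completions of the empty prefix

completes⁺ : ∀ {n} {w : Vec ℕ n} → IsInvSeq w → ¬ Has201 w → ¬ Has210 w → Completes 0 0 [] w
completes⁺ {w = w} inv no201 no210 = record
  { bounded = λ i → ℕ.s≤s⁻¹ (inv i)
  ; low-∈   = λ _ ()
  ; low-≡   = λ _ _ ()
  ; avoids  = equal
  }
  where
  -- Two different later values below `lookup w i` form 201 or 210, according to their order.
  ordered : ∀ i j l → i Fin.< j → j Fin.< l → lookup w j < lookup w i → lookup w l < lookup w i → lookup w j ≡ lookup w l
  ordered i j l i<j j<l wj<wi wl<wi with ℕₚ.<-cmp (lookup w j) (lookup w l)
  ... | tri< wj<wl _ _ = contradiction (i , j , l , i<j , j<l , wj<wl , wl<wi) no201
  ... | tri≈ _ wj≡wl _ = wj≡wl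
  ... | tri> _ _ wl<wj = contradiction (i , j , l , i<j , j<l , wl<wj , wj<wi) no210

  equal : ∀ i j l → i Fin.< j → i Fin.< l → lookup w j < lookup w i → lookup w l < lookup w i → lookup w j ≡ lookup w l
  equal i j l i<j i<l wj<wi wl<wi with Finₚ.<-cmp j l
  ... | tri< j<l _ _  = ordered i j l i<j j<l wj<wi wl<wi
  ... | tri≈ _ refl _ = refl
  ... | tri> _ _ l<j  = sym (ordered i l j i<l l<j wl<wi wj<wi)

module _ {n : ℕ} {w : Vec ℕ n} (c : Completes 0 0 [] w) where
  open Completes c

  completes⇒isInvSeq : IsInvSeq w
  completes⇒isInvSeq i = s≤s (bounded i)

  completes⇒¬201 : ¬ Has201 w
  completes⇒¬201 (i , j , l , i<j , j<l , wj<wl , wl<wi) =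
    ℕₚ.<⇒≢ wj<wl (avoids i j l i<j (Finₚ.<-trans i<j j<l) (ℕₚ.<-trans wj<wl wl<wi) wl<wi)

  completes⇒¬210 : ¬ Has210 w
  completes⇒¬210 (i , j , l , i<j , j<l , wl<wj , wj<wi) =
    ℕₚ.>⇒≢ wl<wj (avoids i j l i<j (Finₚ.<-trans i<j j<l) wj<wi (ℕₚ.<-trans wl<wj wj<wi))

lookup-injective : ∀ {A : Set} {xs : List A} → Unique xs → ∀ i j → List.lookup xs i ≡ List.lookup xs j → i ≡ j
lookup-injective (x∉xs ∷ xs!) zero    zero    eq = refl
lookup-injective (x∉xs ∷ xs!) zero    (suc j) eq = contradiction eq (All.lookup x∉xs (∈-lookup j))
lookup-injective (x∉xs ∷ xs!) (suc i) zero    eq = contradiction (sym eq) (All.lookup x∉xs (∈-lookup i))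
lookup-injective (x∉xs ∷ xs!) (suc i) (suc j) eq = cong suc (lookup-injective xs! i j eq)

I₂₀₁₋₂₁₀-finite : ∀ n → Fin (completions n 0 0) ↔ I₂₀₁₋₂₁₀ n
I₂₀₁₋₂₁₀-finite n = subst (λ c → Fin c ↔ I₂₀₁₋₂₁₀ n) (length-sequences n 0 0 []) (mk↔ₛ′ to from to∘from from∘to)
  where
  xs : List (Vec ℕ n)
  xs = sequences n 0 0 []

  completes : ∀ i → Completes 0 0 [] (List.lookup xs i)
  completes i = sequences-sound n 0 0 [] [] (∈-lookup i)

  to : Fin (length xs) → I₂₀₁₋₂₁₀ n
  to i = mk (List.lookup xs i) (completes⇒isInvSeq (completes i)) (completes⇒¬201 (completes i)) (completes⇒¬210 (completes i))

  member : (e : I₂₀₁₋₂₁₀ n) → I₂₀₁₋₂₁₀.seq e ∈ xs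
  member (mk w inv no201 no210) =
    -- The proofs stored in `e` are irrelevant, so the membership derived from them is recovered by
    -- deciding it.
    recompute (_∈?_ (≡-dec ℕ._≟_) w xs) (sequences-complete n 0 0 [] (completes⁺ inv no201 no210))

  from : I₂₀₁₋₂₁₀ n → Fin (length xs)
  from e = Any.index (member e)

  seq-injective : ∀ {e e′ : I₂₀₁₋₂₁₀ n} → I₂₀₁₋₂₁₀.seq e ≡ I₂₀₁₋₂₁₀.seq e′ → e ≡ e′
  seq-injective refl = refl

  to∘from : ∀ e → to (from e) ≡ e
  to∘from e = seq-injective (sym (lookup-index (member e)))

  from∘to : ∀ i → from (to i) ≡ i
  -- The index found carries the same entry as `i`; without repetitions in the enumeration, equal
  -- entries force equal indices.
  from∘to i = lookup-injective (sequences-unique n 0 0 [] [] []) _ _ (sym (lookup-index (member (to i))))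

-- Generating functions

-- powV p is the p-th power of V = 1 + 2XV², read off from V^(p+1) = V^p + 2XV^(p+2).
powV : ℕ → Series
powV zero    n       = const (+ 1) n
powV (suc p) zero    = powV p zero
powV (suc p) (suc n) = powV p (suc n) ℤ.+ + 2 ℤ.* powV (suc (suc p)) n

-- GpowV p is G V^p for the series G = 1 + XG(1 + V).
GpowV : ℕ → Series
GpowV zero    zero    = + 1
GpowV zero    (suc n) = GpowV 0 n ℤ.+ GpowV 1 n
GpowV (suc p) zero    = GpowV p zero
GpowV (suc p) (suc n) = GpowV p (suc n) ℤ.+ + 2 ℤ.* GpowV (suc (suc p)) n

-- `W` stands for XV², which `W-equation` confirms. Since V = 1 + 2W, identities in V become
-- polynomial identities in `W`.
W V G : Series
W = X ⊛ powV 2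
V = const (+ 1) ⊕ const (+ 2) ⊛ W
G = GpowV 0

-- The relation F(p+1) = F(p) + 2X F(p+2) is common to the powers of V and their multiples by G, so
-- one proof about products covers both families.
record VRecurrence (F : ℕ → Series) : Set where
  field
    at-zero : ∀ p → F (suc p) 0 ≡ F p 0
    at-suc  : ∀ p n → F (suc p) (suc n) ≡ F p (suc n) ℤ.+ + 2 ℤ.* F (suc (suc p)) n

  series : ∀ p → F (suc p) ≈ F p ⊕ const (+ 2) ⊛ (X ⊛ F (suc (suc p)))
  series p zero    = trans (at-zero p) (sym (ℤₚ.+-identityʳ (F p 0)))
  series p (suc n) = trans (at-suc p n) (cong (λ z → F p (suc n) ℤ.+ z)
    (sym (trans (const-⊛ (+ 2) (X ⊛ F (suc (suc p))) (suc n)) (cong (+ 2 ℤ.*_) (X-⊛ (F (suc (suc p))) n)))))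

powV-recurrence : VRecurrence powV
powV-recurrence = record { at-zero = λ _ → refl ; at-suc = λ _ _ → refl }

GpowV-recurrence : VRecurrence GpowV
GpowV-recurrence = record { at-zero = λ _ → refl ; at-suc = λ _ _ → refl }

module _ {F : ℕ → Series} (F-rec : VRecurrence F) where

  ⊛-powV-recurrence : ∀ q → VRecurrence (λ p → F q ⊛ powV p)
  ⊛-powV-recurrence q = record
    { at-zero = λ _ → refl
    ; at-suc  = λ p n → trans (eq p (suc n)) (cong (λ z → (F q ⊛ powV p) (suc n) ℤ.+ z)
        (trans (const-⊛ (+ 2) (X ⊛ (F q ⊛ powV (suc (suc p)))) (suc n))
               (cong (+ 2 ℤ.*_) (X-⊛ (F q ⊛ powV (suc (suc p))) n))))
    }
    where
    eq : ∀ p → F q ⊛ powV (suc p) ≈ F q ⊛ powV p ⊕ const (+ 2) ⊛ (X ⊛ (F q ⊛ powV (suc (suc p))))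
    eq p = ≈-trans (⊛-congˡ {F q} (VRecurrence.series powV-recurrence p))
      (solve 4 (λ f a x b → f :* (a :+ con (+ 2) :* (x :* b)) := f :* a :+ con (+ 2) :* (x :* (f :* b)))
        ≈-refl (F q) (powV p) X (powV (suc (suc p))))

  -- Both sides satisfy the same recurrence in `p` and agree at `p = 0`. Coefficient `suc n` at
  -- `suc p` depends on coefficient `suc n` at `p` and coefficient `n` at `p + 2`, so induction on
  -- the coefficient index and then on `p` suffices. Consequently `powV 2` is V² and `GpowV 1` is
  -- GV.
  ⊛-powV : ∀ q p → F q ⊛ powV p ≈ F (p ℕ.+ q)
  ⊛-powV q zero    n       = trans (⊛-comm (F q) (powV 0) n) (⊛-identityˡ (F q) n)
  ⊛-powV q (suc p) zero    = trans (⊛-powV q p zero) (sym (VRecurrence.at-zero F-rec (p ℕ.+ q)))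
  ⊛-powV q (suc p) (suc n) = trans (VRecurrence.at-suc (⊛-powV-recurrence q) p n)
    (trans (cong₂ (λ y z → y ℤ.+ + 2 ℤ.* z) (⊛-powV q p (suc n)) (⊛-powV q (suc (suc p)) n))
           (sym (VRecurrence.at-suc F-rec (p ℕ.+ q) n)))

powV-1 : powV 1 ≈ V
powV-1 = VRecurrence.series powV-recurrence 0

W-equation : X ⊛ (V ⊛ V) ≈ W
W-equation = ⊛-congˡ {X} (≈-trans (⊛-cong (≈-sym powV-1) (≈-sym powV-1)) (⊛-powV powV-recurrence 1 1))

G-equation : const (+ 1) ⊕ X ⊛ (G ⊕ G ⊛ V) ≈ G
G-equation n = trans (cong (λ z → const (+ 1) n ℤ.+ z)
    (⊛-congˡ {X} (⊕-congˡ {G} (≈-trans (⊛-congˡ {G} (≈-sym powV-1)) (⊛-powV GpowV-recurrence 0 1))) n)) (unfold n)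
  where
  unfold : const (+ 1) ⊕ X ⊛ (G ⊕ GpowV 1) ≈ G
  unfold zero    = refl
  unfold (suc n) = trans (ℤₚ.+-identityˡ _) (X-⊛ (G ⊕ GpowV 1) n)

-- Closed forms for the counting recurrence

geo : ℕ → Series
geo zero    = const (+ 0)
geo (suc p) = const (+ 1) ⊕ V ⊛ geo p

-- `P p t` is to be the generating function of `completions m (suc p) t` and `R p t` that of
-- `weakAscents m p t`; the index of `P` is one behind `k`. As `geo p` is 1 + V + ... + V^(p-1), V^p
-- equals 1 + 2W `geo p`, and the factor next to t in `P` is XV^(p+2).
P R : ℕ → ℕ → Series
P p t = G ⊛ (const (+ 1) ⊕ W ⊛ geo p ⊕ const (+ t) ⊛ (W ⊛ (const (+ 1) ⊕ const (+ 2) ⊛ (W ⊛ geo p))))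
R p t = G ⊛ (geo (suc p) ⊛ (const (+ 1) ⊕ const (+ t) ⊛ W))

P-zero : P 0 0 ≈ G
P-zero = solve 2 (λ g w → g :* (con (+ 1) :+ w :* con (+ 0) :+ con (+ 0) :* (w :* (con (+ 1) :+ con (+ 2) :* (w :* con (+ 0))))) := g)
  ≈-refl G W

R-zero : ∀ t → R 0 t ≈ P 0 t
R-zero t = solve 3 (λ g w τ →
    g :* ((con (+ 1) :+ (con (+ 1) :+ con (+ 2) :* w) :* con (+ 0)) :* (con (+ 1) :+ τ :* w))
    := g :* (con (+ 1) :+ w :* con (+ 0) :+ τ :* (w :* (con (+ 1) :+ con (+ 2) :* (w :* con (+ 0))))))
  ≈-refl G W (const (+ t))

const-suc : ∀ t → const (+ suc t) ≈ const (+ 1) ⊕ const (+ t)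
const-suc t zero    = refl
const-suc t (suc n) = refl

-- With V = 1 + 2W this is a polynomial identity. Together with `R-zero` it makes `R p t` the sum of
-- `P (p - i) (t + i)` over 0 ≤ i ≤ p.
R-suc : ∀ p t → R (suc p) t ≈ P (suc p) t ⊕ R p (suc t)
R-suc p t = ≈-trans
  (solve 4 (λ g w b τ →
      g :* ((con (+ 1) :+ (con (+ 1) :+ con (+ 2) :* w) :* b) :* (con (+ 1) :+ τ :* w))
      := g :* (con (+ 1) :+ w :* b :+ τ :* (w :* (con (+ 1) :+ con (+ 2) :* (w :* b))))
         :+ g :* (b :* (con (+ 1) :+ (con (+ 1) :+ τ) :* w)))
    ≈-refl G W (geo (suc p)) (const (+ t)))
  (⊕-congˡ {P (suc p) t} (⊛-congˡ {G} (⊛-congˡ {geo (suc p)} (⊕-congˡ {const (+ 1)} (⊛-congʳ {W} (≈-sym (const-suc t)))))))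

-- This is the recurrence of `completions` summed over `m`, the 1 being the term `m = 0`. Since
-- `P p t` is G + W `H`, the left side is arranged as the left side of `G-equation` plus XV² `H`.
P-equation : ∀ p t → const (+ 1) ⊕ X ⊛ (const (+ t) ⊛ P (suc p) 1 ⊕ R (suc p) t) ≈ P p t
P-equation p t = begin
  const (+ 1) ⊕ X ⊛ (const (+ t) ⊛ P (suc p) 1 ⊕ R (suc p) t)
    ≈⟨ solve 5 (λ x g w a τ →
         let v = con (+ 1) :+ con (+ 2) :* w
             b = con (+ 1) :+ v :* a
         in con (+ 1) :+ x :* (τ :* (g :* (con (+ 1) :+ w :* b :+ con (+ 1) :* (w :* (con (+ 1) :+ con (+ 2) :* (w :* b)))))
                              :+ g :* ((con (+ 1) :+ v :* b) :* (con (+ 1) :+ τ :* w)))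
            := (con (+ 1) :+ x :* (g :+ g :* v)) :+ (x :* (v :* v)) :* (g :* (a :+ τ :* (con (+ 1) :+ con (+ 2) :* (w :* a)))))
         ≈-refl X G W (geo p) (const (+ t)) ⟩
  (const (+ 1) ⊕ X ⊛ (G ⊕ G ⊛ V)) ⊕ (X ⊛ (V ⊛ V)) ⊛ H
    ≈⟨ ⊕-cong G-equation (⊛-congʳ {H} W-equation) ⟩
  G ⊕ W ⊛ H
    ≈⟨ solve 4 (λ g w a τ →
         g :+ w :* (g :* (a :+ τ :* (con (+ 1) :+ con (+ 2) :* (w :* a))))
         := g :* (con (+ 1) :+ w :* a :+ τ :* (w :* (con (+ 1) :+ con (+ 2) :* (w :* a)))))
         ≈-refl G W (geo p) (const (+ t)) ⟩
  P p t ∎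
  where
  open SetoidReasoning seriesSetoid
  H : Series
  H = G ⊛ (geo p ⊕ const (+ t) ⊛ (const (+ 1) ⊕ const (+ 2) ⊛ (W ⊛ geo p)))

mutual
  completions-P : ∀ m p t → + completions m (suc p) t ≡ P p t m
  -- At index 0 the left side of `P-equation` computes to 1.
  completions-P zero    p t = P-equation p t 0
  completions-P (suc m) p t = begin
    + (t ℕ.* completions m (suc (suc p)) 1 ℕ.+ weakAscents m (suc p) t)
      ≡⟨ ℤₚ.pos-+ (t ℕ.* completions m (suc (suc p)) 1) _ ⟩
    + (t ℕ.* completions m (suc (suc p)) 1) ℤ.+ + weakAscents m (suc p) t
      ≡⟨ cong (ℤ._+ + weakAscents m (suc p) t) (ℤₚ.pos-* t _) ⟩
    + t ℤ.* + completions m (suc (suc p)) 1 ℤ.+ + weakAscents m (suc p) t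
      ≡⟨ cong₂ (λ y z → + t ℤ.* y ℤ.+ z) (completions-P m (suc p) 1) (weakAscents-R m (suc p) t) ⟩
    + t ℤ.* P (suc p) 1 m ℤ.+ R (suc p) t m
      ≡⟨ cong (ℤ._+ R (suc p) t m) (const-⊛ (+ t) (P (suc p) 1) m) ⟨
    (const (+ t) ⊛ P (suc p) 1 ⊕ R (suc p) t) m
      ≡⟨ X-⊛ (const (+ t) ⊛ P (suc p) 1 ⊕ R (suc p) t) m ⟨
    (X ⊛ (const (+ t) ⊛ P (suc p) 1 ⊕ R (suc p) t)) (suc m)
      ≡⟨ ℤₚ.+-identityˡ _ ⟨
    (const (+ 1) ⊕ X ⊛ (const (+ t) ⊛ P (suc p) 1 ⊕ R (suc p) t)) (suc m)
      ≡⟨ P-equation p t (suc m) ⟩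
    P p t (suc m) ∎
    where open ≡-Reasoning

  weakAscents-R : ∀ m p t → + weakAscents m p t ≡ R p t m
  weakAscents-R m zero    t = trans (completions-P m 0 t) (sym (R-zero t m))
  weakAscents-R m (suc p) t = trans (ℤₚ.pos-+ (completions m (suc (suc p)) t) _)
    (trans (cong₂ ℤ._+_ (completions-P m (suc p) t) (weakAscents-R m p (suc t))) (sym (R-suc p t m)))

-- Cancellation and uniqueness of square roots

⊛-vanishing : ∀ f g n → (∀ k → k ℕ.≤ n → g k ≡ + 0) → (f ⊛ g) n ≡ + 0
⊛-vanishing f g zero    g≡0 = trans (cong (f 0 ℤ.*_) (g≡0 0 z≤n)) (ℤₚ.*-zeroʳ (f 0))
⊛-vanishing f g (suc n) g≡0 = trans (⊛-suc f g n) (cong₂ ℤ._+_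
  (trans (cong (f 0 ℤ.*_) (g≡0 (suc n) ℕₚ.≤-refl)) (ℤₚ.*-zeroʳ (f 0)))
  (⊛-vanishing (tail f) g n (λ k k≤n → g≡0 k (ℕₚ.m≤n⇒m≤1+n k≤n))))

-- If `g` vanishes up to index `n`, coefficient `suc n` of `f ⊛ g` is `f 0` times that of `g`, and
-- the integers have no zero divisors.
⊛-cancelˡ-0 : ∀ f g → f 0 ≢ + 0 → f ⊛ g ≈ poly [] → g ≈ poly []
⊛-cancelˡ-0 f g f0≢0 fg≈0 n = below n n ℕₚ.≤-refl
  where
  factor : ∀ z → f 0 ℤ.* z ≡ + 0 → z ≡ + 0
  factor z eq with ℤₚ.i*j≡0⇒i≡0∨j≡0 (f 0) eq
  ... | inj₁ f0≡0 = contradiction f0≡0 f0≢0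
  ... | inj₂ z≡0  = z≡0

  below : ∀ n k → k ℕ.≤ n → g k ≡ + 0
  below zero    zero z≤n = factor (g 0) (fg≈0 0)
  below (suc n) k    k≤1+n with ℕₚ.m≤n⇒m<n∨m≡n k≤1+n
  ... | inj₁ (s≤s k≤n) = below n k k≤n
  ... | inj₂ refl      = factor (g (suc n)) (begin
    f 0 ℤ.* g (suc n)                       ≡⟨ ℤₚ.+-identityʳ _ ⟨
    f 0 ℤ.* g (suc n) ℤ.+ + 0               ≡⟨ cong (λ z → f 0 ℤ.* g (suc n) ℤ.+ z) (⊛-vanishing (tail f) g n (below n)) ⟨
    f 0 ℤ.* g (suc n) ℤ.+ (tail f ⊛ g) n    ≡⟨ ⊛-suc f g n ⟨
    (f ⊛ g) (suc n)                         ≡⟨ fg≈0 (suc n) ⟩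
    + 0                                     ∎)
    where open ≡-Reasoning

-- The product (f + g)(f - g) is zero, and f + g has constant term 2, so it can be cancelled.
sqrt-unique : ∀ f g → f 0 ≡ + 1 → g 0 ≡ + 1 → f ⊛ f ≈ g ⊛ g → f ≈ g
sqrt-unique f g f0 g0 f²≈g² n = ℤₚ.i-j≡0⇒i≡j (f n) (g n) (⊛-cancelˡ-0 (f ⊕ g) (f ⊖ g)
  (λ eq → contradiction (trans (sym (cong₂ ℤ._+_ f0 g0)) eq) λ ())
  (λ k → trans (difference-of-squares k) (ℤₚ.i≡j⇒i-j≡0 (f²≈g² k))) n)
  where
  difference-of-squares : (f ⊕ g) ⊛ (f ⊖ g) ≈ f ⊛ f ⊖ g ⊛ g
  difference-of-squares = solve 2 (λ f g → (f :+ g) :* (f :- g) := f :* f :- g :* g) ≈-refl f g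

-- Elimination of V

⊖-cong : ∀ {f f′ g g′} → f ≈ f′ → g ≈ g′ → f ⊖ g ≈ f′ ⊖ g′
⊖-cong p q n = cong₂ ℤ._-_ (p n) (q n)

poly₂ : ∀ a b → poly (a ∷ b ∷ []) ≈ const a ⊕ X ⊛ const b
poly₂ a b = poly-∷ a (b ∷ [])

poly₃ : ∀ a b c → poly (a ∷ b ∷ c ∷ []) ≈ const a ⊕ X ⊛ (const b ⊕ X ⊛ const c)
poly₃ a b c = ≈-trans (poly-∷ a (b ∷ c ∷ [])) (⊕-congˡ {const a} (⊛-congˡ {X} (poly₂ b c)))

-- `q` is the leading coefficient of the quadratic equation. The other root of V = 1 + 2XV² is
-- 1/(2X) - V, so `r` is twice the conjugate of 1 - X - XV, and multiplying by it rationalises G =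
-- 1/(1 - X - XV).
q r : Series
q = const (+ 1) ⊕ X ⊛ (const (- + 2) ⊕ X ⊛ const (+ 2))
r = const (+ 1) ⊕ X ⊛ (const (+ 2) ⊛ V) ⊖ const (+ 2) ⊛ X

-- q = (1 - X - XV) r and (1 - X - XV) G = 1.
q⊛G≈r : q ⊛ G ≈ r
q⊛G≈r = begin
  q ⊛ G
    -- The solver knows no relation between X, W and G, so the differences that vanish by
    -- `G-equation` and `W-equation` are carried along explicitly.
    ≈⟨ solve 3 (λ x w g →
         let v = con (+ 1) :+ con (+ 2) :* w in
         (con (+ 1) :+ x :* (con (- + 2) :+ x :* con (+ 2))) :* g
         := (con (+ 1) :+ x :* (con (+ 2) :* v) :- con (+ 2) :* x) :* (g :- (con (+ 1) :+ x :* (g :+ g :* v)) :+ con (+ 1))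
            :+ con (+ 2) :* (x :* g) :* (x :* (v :* v) :- w))
         ≈-refl X W G ⟩
  r ⊛ (G ⊖ (const (+ 1) ⊕ X ⊛ (G ⊕ G ⊛ V)) ⊕ const (+ 1)) ⊕ const (+ 2) ⊛ (X ⊛ G) ⊛ (X ⊛ (V ⊛ V) ⊖ W)
    ≈⟨ ⊕-cong (⊛-congˡ {r} (⊕-congʳ {const (+ 1)} (⊖-cong {f = G} ≈-refl G-equation)))
              (⊛-congˡ {const (+ 2) ⊛ (X ⊛ G)} (⊖-cong {g = W} W-equation ≈-refl)) ⟩
  r ⊛ (G ⊖ G ⊕ const (+ 1)) ⊕ const (+ 2) ⊛ (X ⊛ G) ⊛ (W ⊖ W)
    ≈⟨ solve 4 (λ r x g w → r :* (g :- g :+ con (+ 1)) :+ con (+ 2) :* (x :* g) :* (w :- w) := r) ≈-refl r X G W ⟩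
  r ∎
  where
  open SetoidReasoning seriesSetoid

-- Taking out the factor X² leaves qG² + (4X - 3)G + 2. Replacing qG by r turns this into 2(1 + XG(1
-- + V) - G), which is zero.
X⊛G-quadratic : ∀ {A} → A ≈ X ⊛ G →
  poly (+ 1 ∷ - + 2 ∷ + 2 ∷ []) ⊛ (A ⊛ A) ⊕ poly (+ 0 ∷ - + 3 ∷ + 4 ∷ []) ⊛ A ⊕ poly (+ 0 ∷ + 0 ∷ + 2 ∷ []) ≈ poly []
X⊛G-quadratic {A} A≈XG = begin
  poly (+ 1 ∷ - + 2 ∷ + 2 ∷ []) ⊛ (A ⊛ A) ⊕ poly (+ 0 ∷ - + 3 ∷ + 4 ∷ []) ⊛ A ⊕ poly (+ 0 ∷ + 0 ∷ + 2 ∷ [])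
    ≈⟨ ⊕-cong (⊕-cong (⊛-cong (poly₃ (+ 1) (- + 2) (+ 2)) (⊛-cong A≈XG A≈XG)) (⊛-cong (poly₃ (+ 0) (- + 3) (+ 4)) A≈XG))
              (poly₃ (+ 0) (+ 0) (+ 2)) ⟩
  q ⊛ (X ⊛ G ⊛ (X ⊛ G)) ⊕ (const (+ 0) ⊕ X ⊛ (const (- + 3) ⊕ X ⊛ const (+ 4))) ⊛ (X ⊛ G)
    ⊕ (const (+ 0) ⊕ X ⊛ (const (+ 0) ⊕ X ⊛ const (+ 2)))
    ≈⟨ solve 3 (λ q x g →
         q :* (x :* g :* (x :* g)) :+ (con (+ 0) :+ x :* (con (- + 3) :+ x :* con (+ 4))) :* (x :* g)
           :+ (con (+ 0) :+ x :* (con (+ 0) :+ x :* con (+ 2)))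
         := x :* x :* (q :* g :* g :+ (con (- + 3) :+ x :* con (+ 4)) :* g :+ con (+ 2)))
         ≈-refl q X G ⟩
  X ⊛ X ⊛ (q ⊛ G ⊛ G ⊕ (const (- + 3) ⊕ X ⊛ const (+ 4)) ⊛ G ⊕ const (+ 2))
    ≈⟨ ⊛-congˡ {X ⊛ X} (⊕-congʳ {const (+ 2)} (⊕-congʳ {(const (- + 3) ⊕ X ⊛ const (+ 4)) ⊛ G} (⊛-congʳ {G} q⊛G≈r))) ⟩
  X ⊛ X ⊛ (r ⊛ G ⊕ (const (- + 3) ⊕ X ⊛ const (+ 4)) ⊛ G ⊕ const (+ 2))
    ≈⟨ solve 3 (λ x v g →
         x :* x :* ((con (+ 1) :+ x :* (con (+ 2) :* v) :- con (+ 2) :* x) :* g :+ (con (- + 3) :+ x :* con (+ 4)) :* g :+ con (+ 2))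
         := con (+ 2) :* (x :* x) :* ((con (+ 1) :+ x :* (g :+ g :* v)) :- g))
         ≈-refl X V G ⟩
  const (+ 2) ⊛ (X ⊛ X) ⊛ ((const (+ 1) ⊕ X ⊛ (G ⊕ G ⊛ V)) ⊖ G)
    ≈⟨ ⊛-congˡ {const (+ 2) ⊛ (X ⊛ X)} (⊖-cong {g = G} G-equation ≈-refl) ⟩
  const (+ 2) ⊛ (X ⊛ X) ⊛ (G ⊖ G)
    ≈⟨ solve 2 (λ x g → con (+ 2) :* (x :* x) :* (g :- g) := con (+ 0)) ≈-refl X G ⟩
  const (+ 0)
    ≈⟨ (λ { zero → refl ; (suc n) → refl }) ⟩
  poly [] ∎
  where
  open SetoidReasoning seriesSetoid

-- Completing the square in 2XV² - V + 1 = 0, whose discriminant is 1 - 8X.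
1-4XV-square : (const (+ 1) ⊖ const (+ 4) ⊛ (X ⊛ V)) ⊛ (const (+ 1) ⊖ const (+ 4) ⊛ (X ⊛ V)) ≈ poly (+ 1 ∷ - + 8 ∷ [])
1-4XV-square = begin
  (const (+ 1) ⊖ const (+ 4) ⊛ (X ⊛ V)) ⊛ (const (+ 1) ⊖ const (+ 4) ⊛ (X ⊛ V))
    ≈⟨ solve 2 (λ x v →
         (con (+ 1) :- con (+ 4) :* (x :* v)) :* (con (+ 1) :- con (+ 4) :* (x :* v))
         := con (+ 1) :- con (+ 8) :* (x :* v) :+ con (+ 16) :* x :* (x :* (v :* v)))
         ≈-refl X V ⟩
  const (+ 1) ⊖ const (+ 8) ⊛ (X ⊛ V) ⊕ const (+ 16) ⊛ X ⊛ (X ⊛ (V ⊛ V))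
    ≈⟨ ⊕-congˡ {const (+ 1) ⊖ const (+ 8) ⊛ (X ⊛ V)} (⊛-congˡ {const (+ 16) ⊛ X} W-equation) ⟩
  const (+ 1) ⊖ const (+ 8) ⊛ (X ⊛ V) ⊕ const (+ 16) ⊛ X ⊛ W
    ≈⟨ solve 2 (λ x w →
         con (+ 1) :- con (+ 8) :* (x :* (con (+ 1) :+ con (+ 2) :* w)) :+ con (+ 16) :* x :* w := con (+ 1) :+ x :* con (- + 8))
         ≈-refl X W ⟩
  const (+ 1) ⊕ X ⊛ const (- + 8)
    ≈⟨ poly₂ (+ 1) (- + 8) ⟨
  poly (+ 1 ∷ - + 8 ∷ []) ∎
  where
  open SetoidReasoning seriesSetoid

-- Multiplying qG = r by 2X gives 2qA = 3X - 4X² - X(1 - 4XV). Both `S` and 1 - 4XV are square roots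
-- of 1 - 8X with constant term 1, hence equal.
X⊛G-closedForm : ∀ {A S} → A ≈ X ⊛ G → S 0 ≡ + 1 → S ⊛ S ≈ poly (+ 1 ∷ - + 8 ∷ []) →
  poly (+ 2 ∷ - + 4 ∷ + 4 ∷ []) ⊛ A ≈ poly (+ 0 ∷ + 3 ∷ - + 4 ∷ []) ⊖ X ⊛ S
X⊛G-closedForm {A} {S} A≈XG S0≡1 S²≈ = begin
  poly (+ 2 ∷ - + 4 ∷ + 4 ∷ []) ⊛ A
    ≈⟨ ⊛-cong (poly₃ (+ 2) (- + 4) (+ 4)) A≈XG ⟩
  (const (+ 2) ⊕ X ⊛ (const (- + 4) ⊕ X ⊛ const (+ 4))) ⊛ (X ⊛ G)
    ≈⟨ solve 2 (λ x g →
         (con (+ 2) :+ x :* (con (- + 4) :+ x :* con (+ 4))) :* (x :* g)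
         := con (+ 2) :* x :* ((con (+ 1) :+ x :* (con (- + 2) :+ x :* con (+ 2))) :* g))
         ≈-refl X G ⟩
  const (+ 2) ⊛ X ⊛ (q ⊛ G)
    ≈⟨ ⊛-congˡ {const (+ 2) ⊛ X} q⊛G≈r ⟩
  const (+ 2) ⊛ X ⊛ r
    ≈⟨ solve 2 (λ x v →
         con (+ 2) :* x :* (con (+ 1) :+ x :* (con (+ 2) :* v) :- con (+ 2) :* x)
         := (con (+ 0) :+ x :* (con (+ 3) :+ x :* con (- + 4))) :- x :* (con (+ 1) :- con (+ 4) :* (x :* v)))
         ≈-refl X V ⟩
  (const (+ 0) ⊕ X ⊛ (const (+ 3) ⊕ X ⊛ const (- + 4))) ⊖ X ⊛ (const (+ 1) ⊖ const (+ 4) ⊛ (X ⊛ V))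
    ≈⟨ ⊖-cong (poly₃ (+ 0) (+ 3) (- + 4)) (⊛-congˡ {X}
         (sqrt-unique S (const (+ 1) ⊖ const (+ 4) ⊛ (X ⊛ V)) S0≡1 refl (≈-trans S²≈ (≈-sym 1-4XV-square)))) ⟨
  poly (+ 0 ∷ + 3 ∷ - + 4 ∷ []) ⊖ X ⊛ S ∎
  where
  open SetoidReasoning seriesSetoid

coeffSeq≈X⊛G : ∀ {a} → IsCoeffSeq a → ser a ≈ X ⊛ G
coeffSeq≈X⊛G     (a0≡0 , _)   zero    = cong +_ a0≡0
coeffSeq≈X⊛G {a} (_    , iso) (suc n) = begin
  + a (suc n)              ≡⟨ cong +_ (↔⇒≡ (↔-trans (iso n) (↔-sym (I₂₀₁₋₂₁₀-finite (suc n))))) ⟩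
  -- The first entry must be 0: `completions (suc n) 0 0` computes to `completions n 1 0`.
  + completions n 1 0      ≡⟨ completions-P n 0 0 ⟩
  P 0 0 n                  ≡⟨ P-zero n ⟩
  G n                      ≡⟨ X-⊛ G n ⟨
  (X ⊛ G) (suc n)          ∎
  where open ≡-Reasoning

theorem4p7 : (a : ℕ → ℕ) → IsCoeffSeq a →
    ((n : ℕ) → (poly (+ 1 ∷ - + 2 ∷ + 2 ∷ []) ⊛ (ser a ⊛ ser a)
    ⊕ poly (+ 0 ∷ - + 3 ∷ + 4 ∷ []) ⊛ ser a
    ⊕ poly (+ 0 ∷ + 0 ∷ + 2 ∷ [])) n ≡ + 0)
    × ((S : ℕ → ℤ) → S 0 ≡ + 1 → ((n : ℕ) → (S ⊛ S) n ≡ poly (+ 1 ∷ - + 8 ∷ []) n) →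
    (n : ℕ) → (poly (+ 2 ∷ - + 4 ∷ + 4 ∷ []) ⊛ ser a) n
    ≡ (poly (+ 0 ∷ + 3 ∷ - + 4 ∷ []) ⊖ poly (+ 0 ∷ + 1 ∷ []) ⊛ S) n)
theorem4p7 a isCoeff = X⊛G-quadratic A≈XG , λ S → X⊛G-closedForm {S = S} A≈XG
  where
  A≈XG : ser a ≈ X ⊛ G
  A≈XG = coeffSeq≈X⊛G isCoeff
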